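{- Let $\iota\colon\mathbf{A}\to\mathbf{B}$ be an isomorphism of commutative bimonoids, and let $e_A\colon\mathbf{A}\hookrightarrow\overline{\mathbf{A}}$ and $e_B\colon\mathbf{B}\hookrightarrow\overline{\mathbf{B}}$ be commutative bimonoids of fractions of $\mathbf{A}$ and $\mathbf{B}$. If $\overline{\mathbf{B}}$ is complemented, then there is a unique embedding of bimonoids $\overline{\iota}\colon\overline{\mathbf{A}}\to\overline{\mathbf{B}}$ extending $\iota$, i.e.\ with $\overline{\iota}\circ e_A=e_B\circ\iota$.
   Context: A bimonoid $\langle A,\leq,\cdot,1,+,0\rangle$ is a poset with two monoid structures ($\cdot$ with unit $1$, $+$ with unit $0$), both operations order preserving in each argument, satisfying hemidistributivity $x\cdot(y+z)\leq(x\cdot y)+z$ and $(z+y)\cdot x\leq z+(y\cdot x)$; commutative if both operations are commutative. Homomorphisms preserve order, $\cdot,1,+,0$; embeddings are homomorphisms that are order embeddings. In a commutative bimonoid, $y$ is a complement of $x$ if $x\cdot y\leq 0$ and $1\leq x+y$; unique if it exists, written $\overline{x}$; complemented means every element has a complement. A commutative bimonoid $\mathbf{C}$ together with an embedding $e\colon\mathbf{A}\hookrightarrow\mathbf{C}$ is a commutative bimonoid of fractions of $\mathbf{A}$ if every element of $\mathbf{C}$ can be written both as $e(a)\cdot\overline{e(b)}$ and as $e(c)+\overline{e(d)}$ for some $a,b,c,d\in\mathbf{A}$ (with the relevant complements existing in $\mathbf{C}$). -}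

module Defs where

open import Level using (Level; _⊔_; suc)
open import Data.Product using (Σ; Σ-syntax; _×_)
open import Relation.Binary.Core using (Rel)
open import Relation.Binary.Structures using (IsPartialOrder)
open import Relation.Binary.PropositionalEquality using (_≡_)
open import Algebra.Core using (Op₂)
open import Algebra.Structures using (IsCommutativeMonoid)

record CommBimonoid (c ℓ : Level) : Set (suc (c ⊔ ℓ)) where
  infixl 7 _·_
  infixl 6 _+_
  infix 4 _≤_
  field
    Carrier        : Set c
    _≤_            : Rel Carrier ℓ
    isPartialOrder : IsPartialOrder _≡_ _≤_
    _·_            : Op₂ Carrier
    _+_            : Op₂ Carrier
    𝟙              : Carrier
    𝟘              : Carrier
    ·-isCommutativeMonoid : IsCommutativeMonoid _≡_ _·_ 𝟙
    +-isCommutativeMonoid : IsCommutativeMonoid _≡_ _+_ 𝟘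
    ·-mono : ∀ {x x′ y y′} → x ≤ x′ → y ≤ y′ → x · y ≤ x′ · y′
    +-mono : ∀ {x x′ y y′} → x ≤ x′ → y ≤ y′ → x + y ≤ x′ + y′
    hemiˡ  : ∀ x y z → x · (y + z) ≤ (x · y) + z
    hemiʳ  : ∀ x y z → (z + y) · x ≤ z + (y · x)

module _ {c ℓ : Level} (A : CommBimonoid c ℓ) where
  open CommBimonoid A

  IsComplement : Carrier → Carrier → Set ℓ
  IsComplement x y = (x · y ≤ 𝟘) × (𝟙 ≤ x + y)

  Complemented : Set (c ⊔ ℓ)
  Complemented = ∀ x → Σ[ y ∈ Carrier ] IsComplement x y

module _ {c₁ ℓ₁ c₂ ℓ₂ : Level} (A : CommBimonoid c₁ ℓ₁) (B : CommBimonoid c₂ ℓ₂) where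
  private
    module A = CommBimonoid A
    module B = CommBimonoid B

  record IsHomomorphism (f : A.Carrier → B.Carrier) : Set (c₁ ⊔ ℓ₁ ⊔ ℓ₂ ⊔ c₂) where
    field
      mono   : ∀ {x y} → x A.≤ y → f x B.≤ f y
      ·-homo : ∀ x y → f (x A.· y) ≡ f x B.· f y
      𝟙-homo : f A.𝟙 ≡ B.𝟙
      +-homo : ∀ x y → f (x A.+ y) ≡ f x B.+ f y
      𝟘-homo : f A.𝟘 ≡ B.𝟘

  record IsEmbedding (f : A.Carrier → B.Carrier) : Set (c₁ ⊔ ℓ₁ ⊔ ℓ₂ ⊔ c₂) where
    field
      isHomomorphism : IsHomomorphism f
      reflect        : ∀ {x y} → f x B.≤ f y → x A.≤ y

  record IsFractions (e : A.Carrier → B.Carrier) : Set (c₁ ⊔ ℓ₁ ⊔ ℓ₂ ⊔ c₂) where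
    field
      isEmbedding : IsEmbedding e
      as-product  : ∀ x → Σ[ a ∈ A.Carrier ] Σ[ b ∈ A.Carrier ] Σ[ y ∈ B.Carrier ]
                      (IsComplement B (e b) y × x ≡ e a B.· y)
      as-sum      : ∀ x → Σ[ c ∈ A.Carrier ] Σ[ d ∈ A.Carrier ] Σ[ y ∈ B.Carrier ]
                      (IsComplement B (e d) y × x ≡ e c B.+ y)

record IsIsomorphism {c₁ ℓ₁ c₂ ℓ₂ : Level} (A : CommBimonoid c₁ ℓ₁) (B : CommBimonoid c₂ ℓ₂)
         (f : CommBimonoid.Carrier A → CommBimonoid.Carrier B) : Set (c₁ ⊔ ℓ₁ ⊔ ℓ₂ ⊔ c₂) where
  field
    isHomomorphism : IsHomomorphism A B f
    inverse        : CommBimonoid.Carrier B → CommBimonoid.Carrier A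
    inverse-homo   : IsHomomorphism B A inverse
    inverseˡ       : ∀ y → f (inverse y) ≡ y
    inverseʳ       : ∀ x → inverse (f x) ≡ x

{-# OPTIONS --safe #-}
-- Complements give residuation: x · y ≤ z iff x ≤ z + ȳ.  Hence a · b̄ ≤ c + d̄ iff
-- a · d ≤ c + b, a condition that can be checked in A.  Put f = eB ∘ ι, so that B̄ is also a
-- bimonoid of fractions of A.  If x = a · b̄ = c + d̄ in Ā, then the corresponding product in
-- B̄ is below the corresponding sum; for the converse, the sum is written as a product and the
-- product as a sum in B̄, and the resulting inequality in A is proved by cutting along x in Ā.
-- So ῑ(a · b̄) = f(a) · f(b)‾ does not depend on the representation and also equals
-- f(c) + f(d)‾, which makes it preserve and reflect the order and preserve both operations.
module Submission where

open import Defs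
open import Level using (Level)
open import Data.Product using (Σ-syntax; _×_; _,_; proj₁; proj₂)
open import Function using (_∘_)
open import Relation.Binary.Bundles using (Poset)
open import Relation.Binary.PropositionalEquality using (_≡_; refl; sym; trans; cong; cong₂; subst; subst₂; module ≡-Reasoning)
open import Relation.Binary.Structures using (module IsPartialOrder)
open import Algebra.Bundles using (CommutativeSemigroup)
open import Algebra.Structures using (module IsCommutativeMonoid)
import Algebra.Properties.CommutativeSemigroup as CommutativeSemigroupProperties
import Relation.Binary.Reasoning.PartialOrder as PosetReasoning

-- Residuation, De Morgan laws and cut in a commutative bimonoid.

module BimonoidProperties {c ℓ : Level} (A : CommBimonoid c ℓ) where
  open CommBimonoid A public
  open IsPartialOrder isPartialOrder public
    using () renaming (refl to ≤-refl; reflexive to ≤-reflexive; antisym to ≤-antisym)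
  open IsCommutativeMonoid ·-isCommutativeMonoid public using ()
    renaming (comm to ·-comm; identityʳ to ·-identityʳ; isCommutativeSemigroup to ·-isCommutativeSemigroup)
  open IsCommutativeMonoid +-isCommutativeMonoid public using ()
    renaming (comm to +-comm; identityˡ to +-identityˡ; identityʳ to +-identityʳ; isCommutativeSemigroup to +-isCommutativeSemigroup)

  poset : Poset c c ℓ
  poset = record { isPartialOrder = isPartialOrder }

  open PosetReasoning poset

  ·-commutativeSemigroup : CommutativeSemigroup c c
  ·-commutativeSemigroup = record { isCommutativeSemigroup = ·-isCommutativeSemigroup }

  +-commutativeSemigroup : CommutativeSemigroup c c
  +-commutativeSemigroup = record { isCommutativeSemigroup = +-isCommutativeSemigroup }

  module ·-Properties = CommutativeSemigroupProperties ·-commutativeSemigroup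
  module +-Properties = CommutativeSemigroupProperties +-commutativeSemigroup

  complement-sym : ∀ {x y} → IsComplement A x y → IsComplement A y x
  complement-sym {x} {y} (xy≤𝟘 , 𝟙≤x+y) =
    subst (_≤ 𝟘) (·-comm x y) xy≤𝟘 , subst (𝟙 ≤_) (+-comm x y) 𝟙≤x+y

  -- Multiply `x` by `𝟙 ≤ y + ȳ` and let hemidistributivity pull `ȳ` out. With `unresiduate`,
  -- multiplication by `y` is left adjoint to addition of `ȳ`.
  residuate : ∀ {x y ȳ z} → IsComplement A y ȳ → x · y ≤ z → x ≤ z + ȳ
  residuate {x} {y} {ȳ} {z} (_ , 𝟙≤y+ȳ) xy≤z = begin
    x            ≡⟨ ·-identityʳ x ⟨
    x · 𝟙        ≤⟨ ·-mono ≤-refl 𝟙≤y+ȳ ⟩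
    x · (y + ȳ)  ≤⟨ hemiˡ x y ȳ ⟩
    x · y + ȳ    ≤⟨ +-mono xy≤z ≤-refl ⟩
    z + ȳ        ∎

  unresiduate : ∀ {x y ȳ z} → IsComplement A y ȳ → x ≤ z + ȳ → x · y ≤ z
  unresiduate {x} {y} {ȳ} {z} (yȳ≤𝟘 , _) x≤z+ȳ = begin
    x · y        ≤⟨ ·-mono x≤z+ȳ ≤-refl ⟩
    (z + ȳ) · y  ≤⟨ hemiʳ y ȳ z ⟩
    z + ȳ · y    ≡⟨ cong (z +_) (·-comm ȳ y) ⟩
    z + y · ȳ    ≤⟨ +-mono ≤-refl yȳ≤𝟘 ⟩
    z + 𝟘        ≡⟨ +-identityʳ z ⟩
    z            ∎

  complement-antitone : ∀ {x y x̄ ȳ} → IsComplement A x x̄ → IsComplement A y ȳ → x ≤ y → ȳ ≤ x̄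
  complement-antitone {x} {y} {x̄} {ȳ} x⊥x̄ (yȳ≤𝟘 , _) x≤y =
    subst (ȳ ≤_) (+-identityˡ x̄) (residuate x⊥x̄ (begin
      ȳ · x  ≤⟨ ·-mono ≤-refl x≤y ⟩
      ȳ · y  ≡⟨ ·-comm ȳ y ⟩
      y · ȳ  ≤⟨ yȳ≤𝟘 ⟩
      𝟘      ∎))

  complement-unique : ∀ {x y z} → IsComplement A x y → IsComplement A x z → y ≡ z
  complement-unique x⊥y x⊥z =
    ≤-antisym (complement-antitone x⊥z x⊥y ≤-refl) (complement-antitone x⊥y x⊥z ≤-refl)

  𝟘-complement : IsComplement A 𝟘 𝟙
  𝟘-complement = ≤-reflexive (·-identityʳ 𝟘) , ≤-reflexive (sym (+-identityˡ 𝟙))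

  -- The De Morgan law that makes `b + b′` the denominator of a product of fractions over `b` and
  -- `b′`.
  +-complement : ∀ {x y x̄ ȳ} → IsComplement A x x̄ → IsComplement A y ȳ → IsComplement A (x + y) (x̄ · ȳ)
  +-complement {x} {y} {x̄} {ȳ} x⊥x̄ y⊥ȳ = below , above
    where
    below : (x + y) · (x̄ · ȳ) ≤ 𝟘
    below = begin
      (x + y) · (x̄ · ȳ)  ≡⟨ ·-Properties.x∙yz≈xz∙y (x + y) x̄ ȳ ⟩
      -- Since `y` is a complement of `ȳ`, unresiduating `x + y ≤ x + y` gives `(x + y) · ȳ ≤ x`.
      (x + y) · ȳ · x̄    ≤⟨ ·-mono (unresiduate (complement-sym y⊥ȳ) ≤-refl) ≤-refl ⟩
      x · x̄              ≤⟨ proj₁ x⊥x̄ ⟩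
      𝟘                  ∎

    above : 𝟙 ≤ (x + y) + x̄ · ȳ
    above = begin
      𝟙                ≤⟨ proj₂ x⊥x̄ ⟩
      x + x̄            ≤⟨ +-mono ≤-refl (residuate (complement-sym y⊥ȳ) ≤-refl) ⟩
      x + (x̄ · ȳ + y)  ≡⟨ +-Properties.x∙yz≈xz∙y x (x̄ · ȳ) y ⟩
      (x + y) + x̄ · ȳ  ∎

  ·-complement : ∀ {x y x̄ ȳ} → IsComplement A x x̄ → IsComplement A y ȳ → IsComplement A (x · y) (x̄ + ȳ)
  ·-complement x⊥x̄ y⊥ȳ = complement-sym (+-complement (complement-sym x⊥x̄) (complement-sym y⊥ȳ))

  -- Each of two residuations moves one complement across as its element, so a comparison of
  -- fractions becomes one of numerators and denominators.
  cross-multiply : ∀ {x y z w ȳ w̄} → IsComplement A y ȳ → IsComplement A w w̄ →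
                   x · ȳ ≤ z + w̄ → x · w ≤ z + y
  cross-multiply {x} {w = w} {ȳ} y⊥ȳ w⊥w̄ xȳ≤z+w̄ =
    residuate (complement-sym y⊥ȳ)
      (subst (_≤ _) (·-Properties.xy∙z≈xz∙y x ȳ w) (unresiduate w⊥w̄ xȳ≤z+w̄))

  -- This is `cross-multiply` with `w̄` and `ȳ` as the elements and `w` and `y` as their
  -- complements.
  cross-divide : ∀ {x y z w ȳ w̄} → IsComplement A y ȳ → IsComplement A w w̄ →
                 x · w ≤ z + y → x · ȳ ≤ z + w̄
  cross-divide y⊥ȳ w⊥w̄ = cross-multiply (complement-sym w⊥w̄) (complement-sym y⊥ȳ)

  -- The cut rule with cut element `u`: hemidistributivity carries the side term `y` out of the
  -- product with `v`.
  cut : ∀ {x y z u v} → x ≤ u + y → u · v ≤ z → x · v ≤ z + y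
  cut {x} {y} {z} {u} {v} x≤u+y uv≤z = begin
    x · v        ≤⟨ ·-mono x≤u+y ≤-refl ⟩
    (u + y) · v  ≡⟨ ·-comm (u + y) v ⟩
    v · (u + y)  ≤⟨ hemiˡ v u y ⟩
    v · u + y    ≡⟨ cong (_+ y) (·-comm v u) ⟩
    u · v + y    ≤⟨ +-mono uv≤z ≤-refl ⟩
    z + y        ∎

-- Transport of complements and inequalities along homomorphisms and embeddings.

module HomomorphismProperties
  {a α c γ : Level} (A : CommBimonoid a α) (C : CommBimonoid c γ)
  {h : CommBimonoid.Carrier A → CommBimonoid.Carrier C} (h-homo : IsHomomorphism A C h) where
  private
    module A = BimonoidProperties A
    module C = BimonoidProperties C
  open IsHomomorphism h-homo public

  complement-homo : ∀ {x y} → IsComplement A x y → IsComplement C (h x) (h y)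
  complement-homo {x} {y} (xy≤𝟘 , 𝟙≤x+y) =
    subst₂ C._≤_ (·-homo x y) 𝟘-homo (mono xy≤𝟘) , subst₂ C._≤_ 𝟙-homo (+-homo x y) (mono 𝟙≤x+y)

  ·≤+-preserve : ∀ {x y z w} → x A.· y A.≤ z A.+ w → h x C.· h y C.≤ h z C.+ h w
  ·≤+-preserve p = subst₂ C._≤_ (·-homo _ _) (+-homo _ _) (mono p)

module EmbeddingProperties
  {a α c γ : Level} (A : CommBimonoid a α) (C : CommBimonoid c γ)
  {e : CommBimonoid.Carrier A → CommBimonoid.Carrier C} (e-emb : IsEmbedding A C e) where
  private
    module A = BimonoidProperties A
    module C = BimonoidProperties C
  open IsEmbedding e-emb public
  open HomomorphismProperties A C isHomomorphism public

  ·≤+-reflect : ∀ {x y z w} → e x C.· e y C.≤ e z C.+ e w → x A.· y A.≤ z A.+ w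
  ·≤+-reflect p = reflect (subst₂ C._≤_ (sym (·-homo _ _)) (sym (+-homo _ _)) p)

-- The map between two bimonoids of fractions `C` and `D` of `A`.

module Extension
  {a α c γ d δ : Level} (A : CommBimonoid a α) (C : CommBimonoid c γ) (D : CommBimonoid d δ)
  (e : CommBimonoid.Carrier A → CommBimonoid.Carrier C) (e-frac : IsFractions A C e)
  (f : CommBimonoid.Carrier A → CommBimonoid.Carrier D) (f-frac : IsFractions A D f)
  (D-complemented : Complemented D) where
  private
    module A = BimonoidProperties A
    module C = BimonoidProperties C
    module D = BimonoidProperties D
    module eF = IsFractions e-frac
    module fF = IsFractions f-frac
    module e = EmbeddingProperties A C eF.isEmbedding
    module f = EmbeddingProperties A D fF.isEmbedding

  product≤sum : ∀ {a b c d y w Y W} →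
    IsComplement C (e b) y → IsComplement C (e d) w → IsComplement D (f b) Y → IsComplement D (f d) W →
    e a C.· y C.≤ e c C.+ w → f a D.· Y D.≤ f c D.+ W
  product≤sum b⊥y d⊥w b⊥Y d⊥W p =
    D.cross-divide b⊥Y d⊥W (f.·≤+-preserve (e.·≤+-reflect (C.cross-multiply b⊥y d⊥w p)))

  product≤sum-reflect : ∀ {a b c d y w Y W} →
    IsComplement C (e b) y → IsComplement C (e d) w → IsComplement D (f b) Y → IsComplement D (f d) W →
    f a D.· Y D.≤ f c D.+ W → e a C.· y C.≤ e c C.+ w
  product≤sum-reflect b⊥y d⊥w b⊥Y d⊥W p =
    C.cross-divide b⊥y d⊥w (e.·≤+-preserve (f.·≤+-reflect (D.cross-multiply b⊥Y d⊥W p)))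

  -- The representations of f c + W and f a · Y involve elements of A that need not have
  -- complements in C, so the inequality cannot be transferred to C by product≤sum-reflect.
  sum≤product : ∀ {x a b c d y w Y W} →
    IsComplement C (e b) y → IsComplement C (e d) w → IsComplement D (f b) Y → IsComplement D (f d) W →
    x ≡ e a C.· y → x ≡ e c C.+ w → f c D.+ W D.≤ f a D.· Y
  sum≤product {x} {a} {b} {c} {d} {y} {w} {Y} {W} b⊥y d⊥w b⊥Y d⊥W x≡ay x≡c+w
    with fF.as-product (f c D.+ W) | fF.as-sum (f a D.· Y)
  ... | a₁ , b₁ , Y₁ , b₁⊥Y₁ , c+W≡a₁Y₁ | c₁ , d₁ , W₁ , d₁⊥W₁ , aY≡c₁+W₁ =
    -- The goal is now a product below a sum, hence amounts to `a₁ · d₁ ≤ c₁ + b₁` in `A`.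
    subst₂ D._≤_ (sym c+W≡a₁Y₁) (sym aY≡c₁+W₁)
      (D.cross-divide b₁⊥Y₁ d₁⊥W₁ (f.·≤+-preserve (e.·≤+-reflect (C.cut a₁≤x+b₁ xd₁≤c₁))))
    where
    -- In `A` this is `a₁ · d ≤ c + b₁`. Back in `C` only `d` is divided out, turning `e c` into `x`
    -- and leaving `e b₁` as a side term; `xd₁≤c₁` is dual.
    a₁≤x+b₁ : e a₁ C.≤ x C.+ e b₁
    a₁≤x+b₁ = subst (e a₁ C.≤_)
      (trans (C.+-Properties.xy∙z≈xz∙y (e c) (e b₁) w) (cong (C._+ e b₁) (sym x≡c+w)))
      (C.residuate d⊥w (e.·≤+-preserve (f.·≤+-reflect
        (D.cross-multiply b₁⊥Y₁ d⊥W (D.≤-reflexive (sym c+W≡a₁Y₁))))))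

    xd₁≤c₁ : x C.· e d₁ C.≤ e c₁
    xd₁≤c₁ = subst (C._≤ e c₁)
      (trans (C.·-Properties.xy∙z≈xz∙y (e a) (e d₁) y) (cong (C._· e d₁) (sym x≡ay)))
      (C.unresiduate (C.complement-sym b⊥y) (e.·≤+-preserve (f.·≤+-reflect
        (D.cross-multiply b⊥Y d₁⊥W₁ (D.≤-reflexive aY≡c₁+W₁)))))

  product≡sum : ∀ {x a b c d y w Y W} →
    IsComplement C (e b) y → IsComplement C (e d) w → IsComplement D (f b) Y → IsComplement D (f d) W →
    x ≡ e a C.· y → x ≡ e c C.+ w → f a D.· Y ≡ f c D.+ W
  product≡sum b⊥y d⊥w b⊥Y d⊥W x≡ay x≡c+w = D.≤-antisym
    (product≤sum b⊥y d⊥w b⊥Y d⊥W (C.≤-reflexive (trans (sym x≡ay) x≡c+w)))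
    (sum≤product b⊥y d⊥w b⊥Y d⊥W x≡ay x≡c+w)

  -- `as-product` supplies a complement of `e b` in `C` only; the one of `f b` in `D` comes from
  -- `D-complemented`.
  extend : C.Carrier → D.Carrier
  extend x = let a , b , _ = eF.as-product x in f a D.· proj₁ (D-complemented (f b))

  extend-sum : ∀ {x c d w W} → IsComplement C (e d) w → IsComplement D (f d) W →
               x ≡ e c C.+ w → extend x ≡ f c D.+ W
  extend-sum {x} d⊥w d⊥W x≡c+w =
    let a , b , y , b⊥y , x≡ay = eF.as-product x in
    product≡sum b⊥y d⊥w (proj₂ (D-complemented (f b))) d⊥W x≡ay x≡c+w

  -- Two product representations of `x` are compared through a sum representation, since
  -- `product≡sum` relates only opposite kinds.
  extend-product : ∀ {x a b y Y} → IsComplement C (e b) y → IsComplement D (f b) Y →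
                   x ≡ e a C.· y → extend x ≡ f a D.· Y
  extend-product {x} b⊥y b⊥Y x≡ay =
    let c , d , w , d⊥w , x≡c+w = eF.as-sum x
        W , d⊥W = D-complemented (f d)
    in trans (extend-sum d⊥w d⊥W x≡c+w) (sym (product≡sum b⊥y d⊥w b⊥Y d⊥W x≡ay x≡c+w))

  extend-extends : ∀ x → extend (e x) ≡ f x
  extend-extends x = trans
    (extend-product
      -- `e x` is the fraction with numerator `x` and denominator `𝟘`, whose complement is `𝟙`.
      (subst (λ o → IsComplement C o C.𝟙) (sym e.𝟘-homo) C.𝟘-complement)
      (subst (λ o → IsComplement D o D.𝟙) (sym f.𝟘-homo) D.𝟘-complement)
      (sym (C.·-identityʳ (e x))))
    (D.·-identityʳ (f x))

  extend-mono : ∀ {x x′} → x C.≤ x′ → extend x D.≤ extend x′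
  extend-mono {x} {x′} x≤x′ =
    -- The smaller element is taken as a product and the larger as a sum, the shape that
    -- `product≤sum` handles.
    let a , b , y , b⊥y , x≡ay = eF.as-product x
        c , d , w , d⊥w , x′≡c+w = eF.as-sum x′
        Y , b⊥Y = D-complemented (f b)
        W , d⊥W = D-complemented (f d)
    in subst₂ D._≤_ (sym (extend-product b⊥y b⊥Y x≡ay)) (sym (extend-sum d⊥w d⊥W x′≡c+w))
         (product≤sum b⊥y d⊥w b⊥Y d⊥W (subst₂ C._≤_ x≡ay x′≡c+w x≤x′))

  extend-reflect : ∀ {x x′} → extend x D.≤ extend x′ → x C.≤ x′
  extend-reflect {x} {x′} p =
    let a , b , y , b⊥y , x≡ay = eF.as-product x
        c , d , w , d⊥w , x′≡c+w = eF.as-sum x′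
        Y , b⊥Y = D-complemented (f b)
        W , d⊥W = D-complemented (f d)
    in subst₂ C._≤_ (sym x≡ay) (sym x′≡c+w)
         (product≤sum-reflect b⊥y d⊥w b⊥Y d⊥W
           (subst₂ D._≤_ (extend-product b⊥y b⊥Y x≡ay) (extend-sum d⊥w d⊥W x′≡c+w) p))

  extend-· : ∀ x x′ → extend (x C.· x′) ≡ extend x D.· extend x′
  extend-· x x′ =
    let a , b , y , b⊥y , x≡ay = eF.as-product x
        a′ , b′ , y′ , b′⊥y′ , x′≡a′y′ = eF.as-product x′
        Y  , b⊥Y   = D-complemented (f b)
        Y′ , b′⊥Y′ = D-complemented (f b′)
    in begin
      extend (x C.· x′)                ≡⟨ extend-product
        (subst (λ o → IsComplement C o _) (sym (e.+-homo b b′)) (C.+-complement b⊥y b′⊥y′))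
        (subst (λ o → IsComplement D o _) (sym (f.+-homo b b′)) (D.+-complement b⊥Y b′⊥Y′))
        (trans (cong₂ C._·_ x≡ay x′≡a′y′) (trans (C.·-Properties.interchange (e a) y (e a′) y′)
          (cong (C._· (y C.· y′)) (sym (e.·-homo a a′))))) ⟩
      f (a A.· a′) D.· (Y D.· Y′)      ≡⟨ cong (D._· (Y D.· Y′)) (f.·-homo a a′) ⟩
      (f a D.· f a′) D.· (Y D.· Y′)    ≡⟨ D.·-Properties.interchange (f a) (f a′) Y Y′ ⟩
      -- By definition this is `extend x D.· extend x′`: `Y` and `Y′` are the complements that
      -- `extend` selects.
      (f a D.· Y) D.· (f a′ D.· Y′)    ∎
    where open ≡-Reasoning

  extend-+ : ∀ x x′ → extend (x C.+ x′) ≡ extend x D.+ extend x′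
  extend-+ x x′ =
    let c , d , w , d⊥w , x≡c+w = eF.as-sum x
        c′ , d′ , w′ , d′⊥w′ , x′≡c′+w′ = eF.as-sum x′
        W  , d⊥W   = D-complemented (f d)
        W′ , d′⊥W′ = D-complemented (f d′)
    in begin
      extend (x C.+ x′)                ≡⟨ extend-sum
        (subst (λ o → IsComplement C o _) (sym (e.·-homo d d′)) (C.·-complement d⊥w d′⊥w′))
        (subst (λ o → IsComplement D o _) (sym (f.·-homo d d′)) (D.·-complement d⊥W d′⊥W′))
        (trans (cong₂ C._+_ x≡c+w x′≡c′+w′) (trans (C.+-Properties.interchange (e c) w (e c′) w′)
          (cong (C._+ (w C.+ w′)) (sym (e.+-homo c c′))))) ⟩
      f (c A.+ c′) D.+ (W D.+ W′)      ≡⟨ cong (D._+ (W D.+ W′)) (f.+-homo c c′) ⟩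
      (f c D.+ f c′) D.+ (W D.+ W′)    ≡⟨ D.+-Properties.interchange (f c) (f c′) W W′ ⟩
      (f c D.+ W) D.+ (f c′ D.+ W′)    ≡⟨ cong₂ D._+_ (extend-sum d⊥w d⊥W x≡c+w) (extend-sum d′⊥w′ d′⊥W′ x′≡c′+w′) ⟨
      extend x D.+ extend x′           ∎
    where open ≡-Reasoning

  extend-isEmbedding : IsEmbedding C D extend
  extend-isEmbedding = record
    { isHomomorphism = record
      { mono   = extend-mono
      ; ·-homo = extend-·
      ; 𝟙-homo = trans (cong extend (sym e.𝟙-homo)) (trans (extend-extends A.𝟙) f.𝟙-homo)
      ; +-homo = extend-+
      ; 𝟘-homo = trans (cong extend (sym e.𝟘-homo)) (trans (extend-extends A.𝟘) f.𝟘-homo)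
      }
    ; reflect = extend-reflect
    }

  -- A homomorphism preserves complements and complements in `D` are unique, so `g` is determined on
  -- fractions by its values on the image of `e`.
  extend-unique : ∀ {g} → IsHomomorphism C D g → (∀ x → g (e x) ≡ f x) → ∀ x → g x ≡ extend x
  extend-unique {g} g-homo g∘e≡f x =
    let a , b , y , b⊥y , x≡ay = eF.as-product x in begin
      g x              ≡⟨ cong g x≡ay ⟩
      g (e a C.· y)    ≡⟨ g.·-homo (e a) y ⟩
      g (e a) D.· g y  ≡⟨ cong₂ D._·_ (g∘e≡f a) (D.complement-unique
        (subst (λ o → IsComplement D o (g y)) (g∘e≡f b) (g.complement-homo b⊥y))
        (proj₂ (D-complemented (f b)))) ⟩
      f a D.· proj₁ (D-complemented (f b))  ∎
    where
    open ≡-Reasoning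
    module g = HomomorphismProperties C D g-homo

-- Reduces the theorem to two bimonoids of fractions of the same `A`: numerators and denominators in
-- `B` are pulled back along `inverse`.
∘-isFractions : ∀ {a α b β c γ} (A : CommBimonoid a α) (B : CommBimonoid b β) (C : CommBimonoid c γ) {ι e} →
                IsIsomorphism A B ι → IsFractions B C e → IsFractions A C (e ∘ ι)
∘-isFractions A B C {ι} {e} ι-iso e-frac = record
  { isEmbedding = record
    { isHomomorphism = record
      { mono   = e.mono ∘ ι.mono
      ; ·-homo = λ x y → trans (cong e (ι.·-homo x y)) (e.·-homo (ι x) (ι y))
      ; 𝟙-homo = trans (cong e ι.𝟙-homo) e.𝟙-homo
      ; +-homo = λ x y → trans (cong e (ι.+-homo x y)) (e.+-homo (ι x) (ι y))
      ; 𝟘-homo = trans (cong e ι.𝟘-homo) e.𝟘-homo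
      }
    -- `ι` reflects the order because `inverse` is monotone.
    ; reflect = λ p → subst₂ (CommBimonoid._≤_ A) (inverseʳ _) (inverseʳ _)
                        (IsHomomorphism.mono inverse-homo (e.reflect p))
    }
  ; as-product = λ x → let a , b , y , b⊥y , x≡ay = as-product x in
      inverse a , inverse b , y ,
      subst (λ z → IsComplement C (e z) y) (sym (inverseˡ b)) b⊥y ,
      trans x≡ay (cong (λ z → e z · y) (sym (inverseˡ a)))
  ; as-sum = λ x → let c , d , w , d⊥w , x≡c+w = as-sum x in
      inverse c , inverse d , w ,
      subst (λ z → IsComplement C (e z) w) (sym (inverseˡ d)) d⊥w ,
      trans x≡c+w (cong (λ z → e z + w) (sym (inverseˡ c)))
  }
  where
  open CommBimonoid C using (_·_; _+_)
  open IsIsomorphism ι-iso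
  open IsFractions e-frac
  module ι = IsHomomorphism isHomomorphism
  module e = EmbeddingProperties B C isEmbedding

mainTheorem11 : {a α b β a′ α′ b′ β′ : Level}
    → (A : CommBimonoid a α) (B : CommBimonoid b β)
    (Ā : CommBimonoid a′ α′) (B̄ : CommBimonoid b′ β′)
    → (ι : CommBimonoid.Carrier A → CommBimonoid.Carrier B) → IsIsomorphism A B ι
    → (eA : CommBimonoid.Carrier A → CommBimonoid.Carrier Ā) → IsFractions A Ā eA
    → (eB : CommBimonoid.Carrier B → CommBimonoid.Carrier B̄) → IsFractions B B̄ eB
    → Complemented B̄
    → Σ[ ῑ ∈ (CommBimonoid.Carrier Ā → CommBimonoid.Carrier B̄) ]
    (IsEmbedding Ā B̄ ῑ
    × (∀ x → ῑ (eA x) ≡ eB (ι x))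
    × (∀ (g : CommBimonoid.Carrier Ā → CommBimonoid.Carrier B̄)
    → IsEmbedding Ā B̄ g → (∀ x → g (eA x) ≡ eB (ι x)) → ∀ y → g y ≡ ῑ y))
mainTheorem11 A B Ā B̄ ι ι-iso eA eA-frac eB eB-frac B̄-complemented =
  extend , extend-isEmbedding , extend-extends ,
  λ g g-emb → extend-unique (IsEmbedding.isHomomorphism g-emb)
  where
  open Extension A Ā B̄ eA eA-frac (eB ∘ ι) (∘-isFractions A B B̄ ι-iso eB-frac) B̄-complemented
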